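{- Let $\mathcal X_1,\mathcal X_2$ be finite sets of secret input values, let $\mathcal W_1,\mathcal W_2$ be sets of guesses, and let $g_1:\mathcal W_1\times\mathcal X_1\to[0,1]$ and $g_2:\mathcal W_2\times\mathcal X_2\to[0,1]$ be gain functions. For any prior $\pi$ on $\mathcal X_1\times\mathcal X_2$ and any joint gain function $g:(\mathcal W_1\times\mathcal W_2)\times(\mathcal X_1\times\mathcal X_2)\to[0,1]$ for $g_1,g_2$, $M^{\min}_{g,\pi}>0$.
   Context: A prior on a finite set is a probability distribution on it. A joint gain function $g$ for $g_1,g_2$ is required to satisfy: $g((w_1,w_2),(x_1,x_2))=0$ if and only if $g_1(w_1,x_1)g_2(w_2,x_2)=0$ (no other relation is assumed). The marginals of $\pi$ are $\pi_1[x_1]=\sum_{x_2\in\mathcal X_2}\pi[x_1,x_2]$ and $\pi_2[x_2]=\sum_{x_1\in\mathcal X_1}\pi[x_1,x_2]$. For $w_1\in\mathcal W_1,w_2\in\mathcal W_2$ let $\mathcal S_{w_1,w_2}=\{(x_1,x_2)\in\mathcal X_1\times\mathcal X_2:\pi[x_1,x_2]\cdot g((w_1,w_2),(x_1,x_2))\ne0\}$, and define $$M^{\min}_{g,\pi}=\min_{w_1\in\mathcal W_1,\,w_2\in\mathcal W_2}\ \min_{(x_1,x_2)\in\mathcal S_{w_1,w_2}}\frac{\pi_1[x_1]g_1(w_1,x_1)\cdot\pi_2[x_2]g_2(w_2,x_2)}{\pi[x_1,x_2]\cdot g((w_1,w_2),(x_1,x_2))}.$$ -}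

module Defs where

open import Level using (Level; suc; _⊔_)
open import Algebra.Bundles using (CommutativeRing)
open import Algebra.Structures using (IsCommutativeRing)
open import Data.Fin.Base using (Fin)
open import Data.List.Base using (List; []; _∷_; allFin; cartesianProduct)
open import Data.List.Membership.Propositional using (_∈_)
open import Data.List.Membership.Propositional.Properties using (∈-allFin; ∈-cartesianProduct⁺)
open import Data.List.Relation.Unary.Any using (here; there)
open import Data.Nat.Base using (ℕ)
open import Data.Product.Base using (Σ; ∃; ∃₂; _×_; _,_; proj₁; proj₂)
open import Data.Sum.Base using (_⊎_; inj₁; inj₂)
open import Function.Bundles using (_⇔_)
open import Relation.Binary.Bundles using (StrictTotalOrder)
open import Relation.Binary.Core using (Rel)
open import Relation.Binary.PropositionalEquality.Core using (_≡_; refl)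
open import Relation.Binary.Structures using (IsStrictTotalOrder)
open import Relation.Nullary using (¬_; yes; no)
open import Relation.Nullary.Construct.Add.Supremum using (_⁺; ⊤⁺; [_])
open import Relation.Unary using (Pred)
import Algebra.Properties.CommutativeMonoid.Sum as Sum
import Relation.Binary.Construct.Add.Supremum.Equality as AddEq
import Relation.Binary.Construct.Add.Supremum.NonStrict as AddNonStrict
import Relation.Binary.Construct.Add.Supremum.Strict as AddStrict
import Relation.Binary.Construct.StrictToNonStrict as ToNonStrict

-- The library has no real numbers, so ℝ is described by its usual
-- axiomatisation as a Dedekind-complete (totally) ordered field.

record OrderedField c ℓ₁ ℓ₂ : Set (suc (c ⊔ ℓ₁ ⊔ ℓ₂)) where
  infix  4 _≈_ _<_ _≉_
  infixl 7 _*_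
  infixl 6 _+_
  infix  8 -_
  field
    Carrier : Set c
    _≈_     : Rel Carrier ℓ₁
    _<_     : Rel Carrier ℓ₂
    _+_ _*_ : Carrier → Carrier → Carrier
    -_      : Carrier → Carrier
    0# 1#   : Carrier

  _≉_ : Rel Carrier ℓ₁
  x ≉ y = ¬ (x ≈ y)

  field
    isCommutativeRing  : IsCommutativeRing _≈_ _+_ _*_ -_ 0# 1#
    isStrictTotalOrder : IsStrictTotalOrder _≈_ _<_
    0≉1                : 0# ≉ 1#
    -- The nonvanishing proof is irrelevant, so an inverse depends on the
    -- element only.
    inverse            : ∀ x → .(x ≉ 0#) → Carrier
    *-inverseʳ         : ∀ x .(x≉0 : x ≉ 0#) → x * inverse x x≉0 ≈ 1#
    +-monoˡ-<          : ∀ z {x y} → x < y → x + z < y + z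
    *-positive         : ∀ {x y} → 0# < x → 0# < y → 0# < x * y

  commutativeRing : CommutativeRing c ℓ₁
  commutativeRing = record { isCommutativeRing = isCommutativeRing }

  strictTotalOrder : StrictTotalOrder c ℓ₁ ℓ₂
  strictTotalOrder = record { isStrictTotalOrder = isStrictTotalOrder }

  open ToNonStrict _≈_ _<_ public using (_≤_)

  UpperBound : ∀ {p} → Pred Carrier p → Carrier → Set (c ⊔ ℓ₁ ⊔ ℓ₂ ⊔ p)
  UpperBound P b = ∀ x → P x → x ≤ b

record RealNumbers c ℓ₁ ℓ₂ : Set (suc (c ⊔ ℓ₁ ⊔ ℓ₂)) where
  field
    orderedField : OrderedField c ℓ₁ ℓ₂

  open OrderedField orderedField public

  field
    complete : (P : Pred Carrier (c ⊔ ℓ₁ ⊔ ℓ₂)) → ∃ P → ∃ (UpperBound P) →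
               ∃ λ s → UpperBound P s × (∀ b → UpperBound P b → s ≤ b)

module Gain {c ℓ₁ ℓ₂} (F : OrderedField c ℓ₁ ℓ₂) where

  open OrderedField F
  open Sum (CommutativeRing.+-commutativeMonoid commutativeRing) using (sum-syntax)
  open AddEq _≈_ using (_≈⁺_)
  open AddNonStrict _≤_ using (_≤⁺_)
  open AddStrict _<_ using (_<⁺_) public

  record GainFunction {a b} (W : Set a) (X : Set b) : Set (a ⊔ b ⊔ c ⊔ ℓ₁ ⊔ ℓ₂) where
    field
      gain     : W → X → Carrier
      gain-≥-0 : ∀ w x → 0# ≤ gain w x
      gain-≤-1 : ∀ w x → gain w x ≤ 1#

  open GainFunction public

  record JointPrior (m n : ℕ) : Set (c ⊔ ℓ₁ ⊔ ℓ₂) where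
    field
      prob     : Fin m × Fin n → Carrier
      prob-≥-0 : ∀ x → 0# ≤ prob x
      prob-sum : ∑[ i < m ] ∑[ j < n ] prob (i , j) ≈ 1#

    marginal₁ : Fin m → Carrier
    marginal₁ x₁ = ∑[ x₂ < n ] prob (x₁ , x₂)

    marginal₂ : Fin n → Carrier
    marginal₂ x₂ = ∑[ x₁ < m ] prob (x₁ , x₂)

  open JointPrior public

  IsJointGain : ∀ {a b p q} {W₁ : Set a} {W₂ : Set b} {X₁ : Set p} {X₂ : Set q} →
                GainFunction W₁ X₁ → GainFunction W₂ X₂ →
                GainFunction (W₁ × W₂) (X₁ × X₂) → Set (a ⊔ b ⊔ p ⊔ q ⊔ ℓ₁)
  IsJointGain g₁ g₂ g = ∀ w₁ w₂ x₁ x₂ →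
    (gain g (w₁ , w₂) (x₁ , x₂) ≈ 0#) ⇔ (gain g₁ w₁ x₁ * gain g₂ w₂ x₂ ≈ 0#)

  -- Minima live in Carrier ⁺ = Carrier ∪ {+∞}.  The minimum is attained,
  -- except that the minimum of the empty set (or of {+∞}) is +∞.
  IsMin : ∀ {p} → Pred (Carrier ⁺) p → Carrier ⁺ → Set (c ⊔ ℓ₁ ⊔ ℓ₂ ⊔ p)
  IsMin P v = (P v ⊎ v ≡ ⊤⁺) × (∀ u → P u → v ≤⁺ u)

  module _ {a b} {W₁ : Set a} {W₂ : Set b} {m n}
           (g₁ : GainFunction W₁ (Fin m)) (g₂ : GainFunction W₂ (Fin n))
           (g : GainFunction (W₁ × W₂) (Fin m × Fin n)) (π : JointPrior m n) where

    𝒮 : W₁ → W₂ → Pred (Fin m × Fin n) ℓ₁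
    𝒮 w₁ w₂ x = prob π x * gain g (w₁ , w₂) x ≉ 0#

    ratio : ∀ w₁ w₂ x → .(𝒮 w₁ w₂ x) → Carrier
    ratio w₁ w₂ x@(x₁ , x₂) x∈𝒮 =
      (marginal₁ π x₁ * gain g₁ w₁ x₁) * (marginal₂ π x₂ * gain g₂ w₂ x₂)
        * inverse (prob π x * gain g (w₁ , w₂) x) x∈𝒮

    IsInnerMin : W₁ → W₂ → Carrier ⁺ → Set (c ⊔ ℓ₁ ⊔ ℓ₂)
    IsInnerMin w₁ w₂ =
      IsMin λ v → ∃ λ x → Σ (𝒮 w₁ w₂ x) λ x∈𝒮 → v ≈⁺ [ ratio w₁ w₂ x x∈𝒮 ]

    -- The guess sets are arbitrary, so the outer minimum is given by the
    -- relation "M is the value of M^min".  IsMmin-exists and IsMmin-unique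
    -- below show that it has a value when the guess sets are finite, and
    -- never more than one.
    IsMmin : Carrier ⁺ → Set (a ⊔ b ⊔ c ⊔ ℓ₁ ⊔ ℓ₂)
    IsMmin = IsMin λ v → ∃₂ λ w₁ w₂ → IsInnerMin w₁ w₂ v

  private
    open IsStrictTotalOrder isStrictTotalOrder using (_≟_; module Eq)
    open AddEq _≈_ using (≈⁺-refl)
    open AddNonStrict _≤_ using (≤⁺-trans; ≤⁺-total; [_]; _≤⊤⁺)

    module SPO = IsStrictTotalOrder isStrictTotalOrder

    ≤-trans : ∀ {x y z} → x ≤ y → y ≤ z → x ≤ z
    ≤-trans = ToNonStrict.trans _≈_ _<_ SPO.isEquivalence SPO.<-resp-≈ SPO.trans

    ≤⁺-refl : ∀ {x} → x ≤⁺ x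
    ≤⁺-refl {⊤⁺}    = ⊤⁺ ≤⊤⁺
    ≤⁺-refl {[ x ]} = [ inj₂ Eq.refl ]

    ≈⁺⇒≥⁺ : ∀ {x y} → x ≈⁺ y → y ≤⁺ x
    ≈⁺⇒≥⁺ AddEq.⊤⁺≈⊤⁺    = ⊤⁺ ≤⊤⁺
    ≈⁺⇒≥⁺ AddEq.[ eq ] = [ inj₂ (Eq.sym eq) ]

    minimum : ∀ {i p} {I : Set i} (P : Pred (Carrier ⁺) p) (f : I → Carrier ⁺) →
              (∀ x → P (f x) ⊎ f x ≡ ⊤⁺) → (xs : List I) →
              ∃ λ v → (P v ⊎ v ≡ ⊤⁺) × (∀ x → x ∈ xs → v ≤⁺ f x)
    minimum P f ok [] = ⊤⁺ , inj₂ refl , λ _ ()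
    minimum P f ok (x ∷ xs) with minimum P f ok xs
    ... | v , ok-v , v≤ with ≤⁺-total (ToNonStrict.total _≈_ _<_ SPO.compare) (f x) v
    ... | inj₁ fx≤v = f x , ok x , λ where
          _ (here refl) → ≤⁺-refl
          y (there y∈)  → ≤⁺-trans ≤-trans fx≤v (v≤ y y∈)
    ... | inj₂ v≤fx = v , ok-v , λ where
          _ (here refl) → v≤fx
          y (there y∈)  → v≤ y y∈

  module _ {a b} {W₁ : Set a} {W₂ : Set b} {m n}
           (g₁ : GainFunction W₁ (Fin m)) (g₂ : GainFunction W₂ (Fin n))
           (g : GainFunction (W₁ × W₂) (Fin m × Fin n)) (π : JointPrior m n) where

    IsInnerMin-exists : ∀ w₁ w₂ → ∃ (IsInnerMin g₁ g₂ g π w₁ w₂)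
    IsInnerMin-exists w₁ w₂ =
      let v , ok-v , v≤ = minimum P f ok (cartesianProduct (allFin m) (allFin n)) in
      v , ok-v , λ { u ((x₁ , x₂) , x∈𝒮 , u≈) →
        ≤⁺-trans ≤-trans (v≤ _ (∈-cartesianProduct⁺ (∈-allFin x₁) (∈-allFin x₂)))
          (≤⁺-trans ≤-trans (f≤ (x₁ , x₂) x∈𝒮) (≈⁺⇒≥⁺ u≈)) }
      where
      P : Pred (Carrier ⁺) _
      P v = ∃ λ x → Σ (𝒮 g₁ g₂ g π w₁ w₂ x) λ x∈𝒮 → v ≈⁺ [ ratio g₁ g₂ g π w₁ w₂ x x∈𝒮 ]

      f : Fin m × Fin n → Carrier ⁺
      f x with (prob π x * gain g (w₁ , w₂) x) ≟ 0#
      ... | yes _   = ⊤⁺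
      ... | no x∈𝒮 = [ ratio g₁ g₂ g π w₁ w₂ x x∈𝒮 ]

      ok : ∀ x → P (f x) ⊎ f x ≡ ⊤⁺
      ok x with (prob π x * gain g (w₁ , w₂) x) ≟ 0#
      ... | yes _   = inj₂ refl
      ... | no x∈𝒮 = inj₁ (x , x∈𝒮 , ≈⁺-refl Eq.refl)

      f≤ : ∀ x (x∈𝒮 : 𝒮 g₁ g₂ g π w₁ w₂ x) → f x ≤⁺ [ ratio g₁ g₂ g π w₁ w₂ x x∈𝒮 ]
      f≤ x x∈𝒮 with (prob π x * gain g (w₁ , w₂) x) ≟ 0#
      ... | yes x∉𝒮 with () ← x∈𝒮 x∉𝒮
      ... | no _    = ≤⁺-refl

    IsMmin-exists : (∃ λ (ws : List W₁) → ∀ w → w ∈ ws) →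
                    (∃ λ (ws : List W₂) → ∀ w → w ∈ ws) →
                    ∃ (IsMmin g₁ g₂ g π)
    IsMmin-exists (ws₁ , ∈ws₁) (ws₂ , ∈ws₂) =
      let v , ok-v , v≤ = minimum P f ok (cartesianProduct ws₁ ws₂) in
      v , ok-v , λ { u (w₁ , w₂ , u-min) →
        ≤⁺-trans ≤-trans (v≤ _ (∈-cartesianProduct⁺ (∈ws₁ w₁) (∈ws₂ w₂)))
          (f≤ w₁ w₂ u-min) }
      where
      P : Pred (Carrier ⁺) _
      P v = ∃₂ λ w₁ w₂ → IsInnerMin g₁ g₂ g π w₁ w₂ v

      f : W₁ × W₂ → Carrier ⁺
      f (w₁ , w₂) = proj₁ (IsInnerMin-exists w₁ w₂)

      ok : ∀ w → P (f w) ⊎ f w ≡ ⊤⁺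
      ok (w₁ , w₂) = inj₁ (w₁ , w₂ , proj₂ (IsInnerMin-exists w₁ w₂))

      f≤ : ∀ w₁ w₂ {u} → IsInnerMin g₁ g₂ g π w₁ w₂ u → f (w₁ , w₂) ≤⁺ u
      f≤ w₁ w₂ (inj₁ Pu   , _) = proj₂ (proj₂ (IsInnerMin-exists w₁ w₂)) _ Pu
      f≤ w₁ w₂ (inj₂ refl , _) = _ ≤⊤⁺

    IsMmin-unique : ∀ {u v} → IsMmin g₁ g₂ g π u → IsMmin g₁ g₂ g π v → u ≤⁺ v × v ≤⁺ u
    IsMmin-unique (Pu , u≤) (Pv , v≤) = below u≤ Pv , below v≤ Pu
      where
      below : ∀ {p} {P : Pred (Carrier ⁺) p} {u v} →
              (∀ w → P w → u ≤⁺ w) → P v ⊎ v ≡ ⊤⁺ → u ≤⁺ v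
      below u≤ (inj₁ Pv)   = u≤ _ Pv
      below u≤ (inj₂ refl) = _ ≤⊤⁺

{-# OPTIONS --safe #-}
module Submission where

open import Defs
open import Algebra.Bundles using (CommutativeRing)
open import Data.Fin.Base using (Fin; zero; suc)
open import Data.Nat.Base using (ℕ; zero; suc)
open import Data.Product.Base using (_×_; _,_)
open import Data.Sum.Base using (inj₁; inj₂)
open import Function.Base using (_∘_)
open import Function.Bundles using (Equivalence)
open import Relation.Binary.Bundles using (StrictTotalOrder)
open import Relation.Binary.Definitions using (tri<; tri≈; tri>)
open import Relation.Binary.PropositionalEquality.Core using (refl)
open import Relation.Nullary using (¬_; contradiction)
open import Relation.Nullary.Construct.Add.Supremum using (_⁺; [_])
import Algebra.Properties.CommutativeMonoid.Sum as Sum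
import Algebra.Properties.Ring as RingProperties
import Relation.Binary.Construct.Add.Supremum.Equality as AddEq
import Relation.Binary.Construct.Add.Supremum.Strict as AddStrict

-- A nonzero denominator π[x₁,x₂] · g(w,x) has positive factors.  Each marginal
-- dominates π[x₁,x₂], and g₁(w₁,x₁) g₂(w₂,x₂) ≠ 0 because g is a joint gain
-- function, so every ratio is positive.  A minimum that exists is attained or
-- is +∞, hence positive as well.

module OrderedFieldProperties {c ℓ₁ ℓ₂} (F : OrderedField c ℓ₁ ℓ₂) where

  open OrderedField F
  open CommutativeRing commutativeRing
    using ( sym; trans; *-congˡ; *-congʳ; zeroˡ; zeroʳ; *-identityˡ
          ; +-cong; +-comm; +-identityˡ; -‿inverseˡ; -‿inverseʳ; -‿cong; +-commutativeMonoid; ring)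
    renaming (refl to ≈-refl)
  open RingProperties ring using (-‿distribˡ-*; -‿distribʳ-*; -‿involutive)
  open Sum +-commutativeMonoid using (sum)
  open StrictTotalOrder strictTotalOrder
    using (compare; asym; <-respˡ-≈; <-respʳ-≈) renaming (trans to <-trans)

  nonNegative∧≉0⇒positive : ∀ {x} → 0# ≤ x → x ≉ 0# → 0# < x
  nonNegative∧≉0⇒positive (inj₁ 0<x) _   = 0<x
  nonNegative∧≉0⇒positive (inj₂ 0≈x) x≉0 = contradiction (sym 0≈x) x≉0

  *-≉0⇒≉0ˡ : ∀ {x y} → x * y ≉ 0# → x ≉ 0#
  *-≉0⇒≉0ˡ xy≉0 x≈0 = xy≉0 (trans (*-congʳ x≈0) (zeroˡ _))

  *-≉0⇒≉0ʳ : ∀ {x y} → x * y ≉ 0# → y ≉ 0#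
  *-≉0⇒≉0ʳ xy≉0 y≈0 = xy≉0 (trans (*-congˡ y≈0) (zeroʳ _))

  +-positive-nonNegative : ∀ {x y} → 0# < x → 0# ≤ y → 0# < x + y
  +-positive-nonNegative {y = y} 0<x 0≤y = bound 0≤y
    where
    -- Strictness comes from shifting `0# < x` by `y`; the two cases of `0# ≤ y` then only have to
    -- put `0#` at or below `y`.
    y<x+y : y < _ + y
    y<x+y = <-respˡ-≈ (+-identityˡ y) (+-monoˡ-< y 0<x)

    bound : 0# ≤ y → 0# < _ + y
    bound (inj₁ 0<y) = <-trans 0<y y<x+y
    bound (inj₂ 0≈y) = <-respˡ-≈ (sym 0≈y) y<x+y

  +-nonNegative-positive : ∀ {x y} → 0# ≤ x → 0# < y → 0# < x + y
  +-nonNegative-positive {x} {y} 0≤x 0<y =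
    <-respʳ-≈ (+-comm y x) (+-positive-nonNegative 0<y 0≤x)

  -- Since `≤` is the disjunction of `<` and `≈`, the head and the tail are split: one strictly
  -- positive part makes the sum positive, and two zero parts make it zero.
  sum-nonNegative : ∀ {n} {f : Fin n → Carrier} → (∀ i → 0# ≤ f i) → 0# ≤ sum f
  sum-nonNegative {zero}  0≤f = inj₂ ≈-refl
  sum-nonNegative {suc n} 0≤f with 0≤f zero
  ... | inj₁ 0<f₀ = inj₁ (+-positive-nonNegative 0<f₀ (sum-nonNegative (0≤f ∘ suc)))
  ... | inj₂ 0≈f₀ with sum-nonNegative (0≤f ∘ suc)
  ...   | inj₁ 0<s = inj₁ (+-nonNegative-positive (0≤f zero) 0<s)
  ...   | inj₂ 0≈s = inj₂ (trans (sym (+-identityˡ 0#)) (+-cong 0≈f₀ 0≈s))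

  -- Used on the marginals, where the distinguished positive summand is the joint probability
  -- itself.
  sum-positive : ∀ {n} {f : Fin n → Carrier} → (∀ i → 0# ≤ f i) →
                 ∀ i → 0# < f i → 0# < sum f
  sum-positive 0≤f zero    0<fi = +-positive-nonNegative 0<fi (sum-nonNegative (0≤f ∘ suc))
  sum-positive 0≤f (suc i) 0<fi = +-nonNegative-positive (0≤f zero) (sum-positive (0≤f ∘ suc) i 0<fi)

  -- If -1 were positive, then its square 1 would be positive too, while adding 1 to both sides of
  -- `0# < - 1#` gives `1# < 0#`.
  0≮-1 : ¬ (0# < - 1#)
  0≮-1 0<-1 = asym 0<1 1<0
    where
    0<1 : 0# < 1#
    0<1 = <-respʳ-≈
      (trans (sym (-‿distribˡ-* 1# (- 1#))) (trans (-‿cong (*-identityˡ (- 1#))) (-‿involutive 1#)))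
      (*-positive 0<-1 0<-1)

    1<0 : 1# < 0#
    1<0 = <-respˡ-≈ (+-identityˡ 1#) (<-respʳ-≈ (-‿inverseˡ 1#) (+-monoˡ-< 1# 0<-1))

  -- By trichotomy: a zero inverse would collapse 0 and 1, and a negative one would make -1 a
  -- product of the positive elements `x` and `- inverse x x≉0`.
  inverse-positive : ∀ {x} .(x≉0 : x ≉ 0#) → 0# < x → 0# < inverse x x≉0
  inverse-positive {x} x≉0 0<x with compare 0# (inverse x x≉0)
  ... | tri< 0<x⁻¹ _ _ = 0<x⁻¹
  ... | tri≈ _ 0≈x⁻¹ _ =
    contradiction (trans (sym (zeroʳ x)) (trans (*-congˡ 0≈x⁻¹) (*-inverseʳ x x≉0))) 0≉1
  ... | tri> _ _ x⁻¹<0 = contradiction 0<-1 0≮-1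
    where
    0<-x⁻¹ : 0# < - inverse x x≉0
    0<-x⁻¹ = <-respˡ-≈ (-‿inverseʳ _) (<-respʳ-≈ (+-identityˡ _) (+-monoˡ-< _ x⁻¹<0))

    0<-1 : 0# < - 1#
    0<-1 = <-respʳ-≈ (trans (sym (-‿distribʳ-* x _)) (-‿cong (*-inverseʳ x x≉0)))
      (*-positive 0<x 0<-x⁻¹)

module GainProperties {c ℓ₁ ℓ₂} (F : OrderedField c ℓ₁ ℓ₂) where

  open OrderedField F
  open Gain F
  open OrderedFieldProperties F
  open CommutativeRing commutativeRing using (sym)
  open StrictTotalOrder strictTotalOrder using (<-respʳ-≈)

  module _ {a b} {W₁ : Set a} {W₂ : Set b} {m n}
           (g₁ : GainFunction W₁ (Fin m)) (g₂ : GainFunction W₂ (Fin n))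
           (g : GainFunction (W₁ × W₂) (Fin m × Fin n)) (π : JointPrior m n)
           (joint : IsJointGain g₁ g₂ g) where

    ratio-positive : ∀ w₁ w₂ x (x∈𝒮 : 𝒮 g₁ g₂ g π w₁ w₂ x) →
                     0# < ratio g₁ g₂ g π w₁ w₂ x x∈𝒮
    ratio-positive w₁ w₂ x@(x₁ , x₂) x∈𝒮 =
      *-positive
        (*-positive (*-positive 0<π₁ 0<g₁) (*-positive 0<π₂ 0<g₂))
        (inverse-positive x∈𝒮 (*-positive 0<π 0<g))
      where
      0<π : 0# < prob π x
      0<π = nonNegative∧≉0⇒positive (prob-≥-0 π x) (*-≉0⇒≉0ˡ x∈𝒮)

      0<π₁ : 0# < marginal₁ π x₁
      -- The summand at index `x₂` is `prob π x`, already known to be positive.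
      0<π₁ = sum-positive (λ j → prob-≥-0 π (x₁ , j)) x₂ 0<π

      0<π₂ : 0# < marginal₂ π x₂
      0<π₂ = sum-positive (λ i → prob-≥-0 π (i , x₂)) x₁ 0<π

      g≉0 : gain g (w₁ , w₂) x ≉ 0#
      g≉0 = *-≉0⇒≉0ʳ x∈𝒮

      0<g : 0# < gain g (w₁ , w₂) x
      0<g = nonNegative∧≉0⇒positive (gain-≥-0 g (w₁ , w₂) x) g≉0

      g₁g₂≉0 : gain g₁ w₁ x₁ * gain g₂ w₂ x₂ ≉ 0#
      -- Contrapositive of the joint gain condition: a vanishing product would force `g` to vanish
      -- at this point.
      g₁g₂≉0 = g≉0 ∘ Equivalence.from (joint w₁ w₂ x₁ x₂)

      0<g₁ : 0# < gain g₁ w₁ x₁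
      0<g₁ = nonNegative∧≉0⇒positive (gain-≥-0 g₁ w₁ x₁) (*-≉0⇒≉0ˡ g₁g₂≉0)

      0<g₂ : 0# < gain g₂ w₂ x₂
      0<g₂ = nonNegative∧≉0⇒positive (gain-≥-0 g₂ w₂ x₂) (*-≉0⇒≉0ʳ g₁g₂≉0)

    innerMin-positive : ∀ {w₁ w₂ v} → IsInnerMin g₁ g₂ g π w₁ w₂ v → [ 0# ] <⁺ v
    innerMin-positive (inj₁ (x , x∈𝒮 , AddEq.[ v≈r ]) , _) =
      -- The attained value is only `≈` to a ratio, so positivity is transported along that
      -- equality.
      AddStrict.[ <-respʳ-≈ (sym v≈r) (ratio-positive _ _ x x∈𝒮) ]
    innerMin-positive (inj₂ refl , _) = AddStrict.[ 0# ]<⊤⁺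

    Mmin-positive : ∀ {M} → IsMmin g₁ g₂ g π M → [ 0# ] <⁺ M
    Mmin-positive (inj₁ (_ , _ , min) , _) = innerMin-positive min
    -- The value +∞ arises when there are no guess pairs or every inner minimum is +∞.
    Mmin-positive (inj₂ refl , _)          = AddStrict.[ 0# ]<⊤⁺

proposition3p4 :
    ∀ {c ℓ₁ ℓ₂ a b} (ℝ : RealNumbers c ℓ₁ ℓ₂) →
    let open RealNumbers ℝ
        open Gain orderedField in
    {m n : ℕ} {W₁ : Set a} {W₂ : Set b}
    (g₁ : GainFunction W₁ (Fin m)) (g₂ : GainFunction W₂ (Fin n))
    (π : JointPrior m n)
    (g : GainFunction (W₁ × W₂) (Fin m × Fin n)) → IsJointGain g₁ g₂ g →
    (M : Carrier ⁺) → IsMmin g₁ g₂ g π M → [ 0# ] <⁺ M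
proposition3p4 ℝ g₁ g₂ π g joint M =
  GainProperties.Mmin-positive (RealNumbers.orderedField ℝ) g₁ g₂ g π joint
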